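{- Fix integers $d\ge 1$ and $n\ge 1$. Then $$\sum_{\lambda\in\mathcal{H}_n} |\{i: 1\le i<\ell(\lambda),\ \lambda_i-\lambda_{i+1}<d\}| \;\ge\; \sum_{\lambda\in\mathcal{H}_n} |\{i: 1\le i\le \ell(\lambda),\ \lambda_i\not\equiv 1 \pmod{d+1}\}|.$$ That is, the total number of indices $i$ with $1\le i<\ell(\lambda)$ and $\lambda_i-\lambda_{i+1}<d$, over all $\lambda\in\mathcal{H}_n$, is at least the total number of parts not congruent to $1$ modulo $d+1$, over all $\lambda\in\mathcal{H}_n$.
   Context: A partition is a finite nonempty weakly decreasing sequence $\lambda=(\lambda_1,\ldots,\lambda_k)$ of positive integers; $\ell(\lambda)=k$ is its number of parts. The perimeter of $\lambda$ is $\Gamma(\lambda)=\lambda_1+\ell(\lambda)-1$, and $\mathcal{H}_n$ is the set of partitions with perimeter $n$. -}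

module Defs where

open import Data.List using (List; []; _∷_; length; filter; map; zip; drop; upTo; cartesianProductWith)
open import Data.List.Membership.Propositional using (_∈_)
open import Data.List.Membership.Propositional.Properties using (∈-cartesianProductWith⁺; ∈-cartesianProductWith⁻; ∈-filter⁺; ∈-filter⁻; ∈-upTo⁺)
open import Data.List.Properties using (∷-injective)
open import Data.List.Relation.Unary.All as All using (All; []; _∷_; all?)
open import Data.List.Relation.Unary.AllPairs using ([]; _∷_)
open import Data.List.Relation.Unary.Any using (here; there)
open import Data.List.Relation.Unary.Linked using (Linked; [-]; _∷_; linked?)
open import Data.List.Relation.Unary.Unique.Propositional using (Unique)
import Data.List.Relation.Unary.Unique.Propositional.Properties as Uniqueₚ
open import Data.Nat using (ℕ; zero; suc; _+_; _∸_; _≤_; _<_; _≥_; s≤s; _≟_; _<?_; _≥?_)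
open import Data.Nat.DivMod using (_%_)
open import Data.Nat.ListAction using (sum)
open import Data.Nat.Properties using (≤-trans; ≤-reflexive; m≤m+n; m≤n+m; +-suc)
open import Data.Product using (_×_; _,_; proj₁; proj₂)
open import Function.Bundles using (_⇔_; mk⇔)
open import Relation.Binary.PropositionalEquality using (_≡_; _≢_; refl; sym)
open import Relation.Nullary using (Dec; ¬?)
open import Relation.Nullary.Decidable using (_×-dec_)

IsPartition : List ℕ → Set
IsPartition xs = 0 < length xs × All (0 <_) xs × Linked _≥_ xs

isPartition? : (xs : List ℕ) → Dec (IsPartition xs)
isPartition? xs = 0 <? length xs ×-dec (all? (0 <?_) xs ×-dec linked? _≥?_ xs)

-- The value at [] is never used: partitions are nonempty.
firstPart : List ℕ → ℕ
firstPart []      = 0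
firstPart (x ∷ _) = x

perimeter : List ℕ → ℕ
perimeter xs = firstPart xs + length xs ∸ 1

-- All lists of length at most k with entries at most m.
listsUpTo : (m k : ℕ) → List (List ℕ)
listsUpTo m zero    = [] ∷ []
listsUpTo m (suc k) = [] ∷ cartesianProductWith _∷_ (upTo (suc m)) (listsUpTo m k)

-- The finite set of partitions of perimeter n, as a list.  A partition of
-- perimeter n has at most n parts, each at most n, so nothing is lost by
-- filtering listsUpTo n n; see ∈-ℋ and ℋ-unique below.
ℋ : ℕ → List (List ℕ)
ℋ n = filter (λ xs → isPartition? xs ×-dec (perimeter xs ≟ n)) (listsUpTo n n)

-- zip xs (drop 1 xs) lists the pairs (λᵢ , λᵢ₊₁) for 1 ≤ i < ℓ(λ).  On
-- partitions λᵢ ≥ λᵢ₊₁, so ∸ is the true difference.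
gapsBelow : ℕ → List ℕ → ℕ
gapsBelow d xs = length (filter (λ (a , b) → a ∸ b <? d) (zip xs (drop 1 xs)))

partsNot≡1Mod1+ : ℕ → List ℕ → ℕ
partsNot≡1Mod1+ d xs = length (filter (λ x → ¬? (x % suc d ≟ 1 % suc d)) xs)

∑ℋ : ℕ → (List ℕ → ℕ) → ℕ
∑ℋ n f = sum (map f (ℋ n))

private
  listsUpTo-complete : ∀ m k {xs} → length xs ≤ k → All (_≤ m) xs → xs ∈ listsUpTo m k
  listsUpTo-complete m zero    {[]}     _       _        = here refl
  listsUpTo-complete m (suc k) {[]}     _       _        = here refl
  listsUpTo-complete m (suc k) {x ∷ xs} (s≤s l) (p ∷ ps) =
    there (∈-cartesianProductWith⁺ _∷_ (∈-upTo⁺ (s≤s p)) (listsUpTo-complete m k l ps))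

  listsUpTo-unique : ∀ m k → Unique (listsUpTo m k)
  listsUpTo-unique m zero    = [] ∷ []
  listsUpTo-unique m (suc k) =
    All.tabulate fresh
      ∷ Uniqueₚ.cartesianProductWith⁺ _∷_ ∷-injective (Uniqueₚ.upTo⁺ (suc m)) (listsUpTo-unique m k)
    where
    fresh : ∀ {ys} → ys ∈ cartesianProductWith _∷_ (upTo (suc m)) (listsUpTo m k) → [] ≢ ys
    fresh p refl with ∈-cartesianProductWith⁻ _∷_ (upTo (suc m)) (listsUpTo m k) p
    ... | _ , _ , _ , _ , ()

  parts≤first : ∀ {x xs} → Linked _≥_ (x ∷ xs) → All (_≤ x) xs
  parts≤first [-]      = []
  parts≤first (p ∷ ps) = p ∷ All.map (λ q → ≤-trans q p) (parts≤first ps)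

  bounded : ∀ {n xs} → IsPartition xs → perimeter xs ≡ n → length xs ≤ n × All (_≤ n) xs
  bounded {n} {suc x ∷ xs} (_ , _ , dec) refl =
    m≤n+m _ x , first ∷ All.map (λ q → ≤-trans q first) (parts≤first dec)
    where
    first : suc x ≤ x + suc (length xs)
    first = ≤-trans (s≤s (m≤m+n x (length xs))) (≤-reflexive (sym (+-suc x (length xs))))
  bounded {n} {zero ∷ xs} (_ , () ∷ _ , _) _

∈-ℋ : ∀ n xs → xs ∈ ℋ n ⇔ (IsPartition xs × perimeter xs ≡ n)
∈-ℋ n xs = mk⇔
  (λ p → proj₂ (∈-filter⁻ P? {xs = listsUpTo n n} p))
  (λ (p , e) → let (l , b) = bounded p e in ∈-filter⁺ P? (listsUpTo-complete n n l b) (p , e))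
  where P? = λ ys → isPartition? ys ×-dec (perimeter ys ≟ n)

ℋ-unique : ∀ n → Unique (ℋ n)
ℋ-unique n = Uniqueₚ.filter⁺ _ (listsUpTo-unique n n)

{-# OPTIONS --safe #-}

-- Every partition of perimeter m + 1 arises from (1) by a unique sequence of m
-- moves, each of which either increases the first part by one or repeats it.
-- A part or a gap counted in a partition is the first part or the first gap of
-- a unique earlier stage, so it suffices to compare, for each m, how often the
-- first part and the first gap are counted.  Complementing, it remains to see
-- that the partitions with a single part or first gap ≥ d are at most as many
-- as those with first part ≡ 1 (mod d + 1).  For m ≤ d there is at most one of
-- the former, and the column (1, …, 1) is one of the latter.  For m ≥ d the
-- former end in d increases, so they are determined by the first m - d moves,
-- and any m - d moves can be followed by d moves leading to one of the latter.
module Submission where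

open import Defs
open import Algebra.Properties.CommutativeSemigroup using (interchange)
open import Data.Bool using (if_then_else_; true; false)
open import Data.List using (List; []; _∷_; _++_; map; length; filter)
open import Data.List.Properties using (map-++; map-∘)
open import Data.List.Membership.Propositional using (_∈_)
open import Data.List.Membership.Propositional.Properties using (∈-map⁺; ∈-map⁻; ∈-++⁺ˡ; ∈-++⁺ʳ; ∈-++⁻)
open import Data.List.Membership.Propositional.Properties.WithK using (unique∧set⇒bag)
open import Data.List.Relation.Binary.BagAndSetEquality using (∼bag⇒↭)
open import Data.List.Relation.Binary.Permutation.Propositional using (_↭_)
import Data.List.Relation.Binary.Permutation.Propositional.Properties as ↭ₚ
open import Data.List.Relation.Unary.All using ([]; _∷_)
open import Data.List.Relation.Unary.AllPairs using ([]; _∷_)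
open import Data.List.Relation.Unary.Any using (here)
open import Data.List.Relation.Unary.Linked using ([-]; _∷_)
open import Data.List.Relation.Unary.Unique.Propositional using (Unique)
import Data.List.Relation.Unary.Unique.Propositional.Properties as Uniqueₚ
open import Data.Nat using (ℕ; zero; suc; _+_; _*_; _∸_; _%_; _≤_; _≥_; z≤n; s≤s; _≟_; _<?_)
open import Data.Nat.DivMod using (m%n<n; m%n%n≡m%n; %-distribˡ-+; [m+kn]%n≡m%n)
open import Data.Nat.ListAction using (sum)
open import Data.Nat.ListAction.Properties using (sum-++; sum-↭)
open import Data.Nat.Properties
open import Data.Product using (_×_; _,_; proj₂; uncurry)
open import Data.Sum using (inj₁; inj₂)
open import Function using (_∘_; mk⇔; Equivalence)
open import Relation.Binary.PropositionalEquality using (_≡_; refl; sym; trans; cong; cong₂; module ≡-Reasoning)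
open import Relation.Nullary using (Dec; yes; no; does; ¬_; ¬?; contradiction)

-- Generation of partitions by widening and repeating the first part

List⁺ : Set
List⁺ = ℕ × List ℕ

toList : List⁺ → List ℕ
toList = uncurry _∷_

widen : List⁺ → List⁺
widen (x , xs) = suc x , xs

repeat : List⁺ → List⁺
repeat (x , xs) = x , x ∷ xs

-- The index counts moves, each of which raises the perimeter by one, so it is the perimeter minus
-- one.
partitions : ℕ → List List⁺
partitions zero    = (1 , []) ∷ []
partitions (suc m) = map widen (partitions m) ++ map repeat (partitions m)

Valid : ℕ → List⁺ → Set
Valid m (x , xs) = IsPartition (x ∷ xs) × x + length xs ≡ suc m

widen-valid : ∀ {m} p → Valid m p → Valid (suc m) (widen p)
widen-valid (x , [])     ((l , _ ∷ ps , _) , e)        = (l , s≤s z≤n ∷ ps , [-]) , cong suc e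
widen-valid (x , y ∷ ys) ((l , _ ∷ ps , x≥y ∷ lk) , e) =
  (l , s≤s z≤n ∷ ps , m≤n⇒m≤1+n x≥y ∷ lk) , cong suc e

repeat-valid : ∀ {m} p → Valid m p → Valid (suc m) (repeat p)
repeat-valid (x , xs) ((_ , x>0 ∷ ps , lk) , e) =
  (s≤s z≤n , x>0 ∷ x>0 ∷ ps , ≤-refl ∷ lk) , trans (+-suc x (length xs)) (cong suc e)

∈-partitions⇒valid : ∀ m {p} → p ∈ partitions m → Valid m p
∈-partitions⇒valid zero    (here refl) = (s≤s z≤n , s≤s z≤n ∷ [] , [-]) , refl
∈-partitions⇒valid (suc m) p∈ with ∈-++⁻ (map widen (partitions m)) p∈
... | inj₁ w with q , q∈ , refl ← ∈-map⁻ widen w  = widen-valid q (∈-partitions⇒valid m q∈)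
... | inj₂ r with q , q∈ , refl ← ∈-map⁻ repeat r = repeat-valid q (∈-partitions⇒valid m q∈)

widen-∈ : ∀ m {p} → p ∈ partitions m → widen p ∈ partitions (suc m)
widen-∈ m p∈ = ∈-++⁺ˡ (∈-map⁺ widen p∈)

repeat-∈ : ∀ m {p} → p ∈ partitions m → repeat p ∈ partitions (suc m)
repeat-∈ m p∈ = ∈-++⁺ʳ (map widen (partitions m)) (∈-map⁺ repeat p∈)

-- The last move can be read off: equal first two parts come from a repetition, while a first part
-- that exceeds the second, or stands alone above 1, comes from a widening. Undoing that move keeps
-- the partition valid.
valid⇒∈-partitions : ∀ m x xs → Valid m (x , xs) → (x , xs) ∈ partitions m
valid⇒∈-partitions _ zero _ ((_ , () ∷ _ , _) , _)
valid⇒∈-partitions zero (suc zero) [] _ = here refl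
valid⇒∈-partitions zero (suc zero) (_ ∷ _) (_ , ())
valid⇒∈-partitions zero (suc (suc x)) _ (_ , ())
valid⇒∈-partitions (suc m) (suc zero) [] (_ , ())
valid⇒∈-partitions (suc m) (suc (suc x)) [] ((l , _ , _) , e) =
  widen-∈ m (valid⇒∈-partitions m (suc x) [] ((l , s≤s z≤n ∷ [] , [-]) , suc-injective e))
valid⇒∈-partitions (suc m) (suc x) (y ∷ ys) ((l , x>0 ∷ y>0 ∷ ps , x≥y ∷ lk) , e) with m≤n⇒m<n∨m≡n x≥y
... | inj₂ refl = repeat-∈ m (valid⇒∈-partitions m (suc x) ys
        ((s≤s z≤n , x>0 ∷ ps , lk) , suc-injective (trans (sym (+-suc (suc x) (length ys))) e)))
... | inj₁ (s≤s y≤x) = widen-∈ m (valid⇒∈-partitions m x (y ∷ ys)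
        ((l , x>0′ ∷ y>0 ∷ ps , y≤x ∷ lk) , suc-injective e))
  where x>0′ = ≤-trans y>0 y≤x

partitions-unique : ∀ m → Unique (partitions m)
partitions-unique zero    = [] ∷ []
partitions-unique (suc m) =
  Uniqueₚ.++⁺ (Uniqueₚ.map⁺ (λ { refl → refl }) (partitions-unique m))
              (Uniqueₚ.map⁺ (λ { refl → refl }) (partitions-unique m))
              disjoint
  where
  disjoint : ∀ {p} → ¬ (p ∈ map widen (partitions m) × p ∈ map repeat (partitions m))
  disjoint (w , r) with ∈-map⁻ widen w | ∈-map⁻ repeat r
  ... | (x , _) , q∈ , refl | _ , _ , refl with ∈-partitions⇒valid m q∈
  -- If a widening gave two equal leading parts, the second part would have exceeded the first
  -- before it.
  ...   | (_ , _ , x≥1+x ∷ _) , _ = 1+n≰n x≥1+x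

ℋ↭partitions : ∀ m → ℋ (suc m) ↭ map toList (partitions m)
-- Both lists are free of duplicates, so having the same members makes them permutations of each
-- other.
ℋ↭partitions m = ∼bag⇒↭ (unique∧set⇒bag (ℋ-unique (suc m))
  (Uniqueₚ.map⁺ (λ { refl → refl }) (partitions-unique m)) (mk⇔ (to _) from))
  where
  perimeter-∷ : ∀ x xs → perimeter (x ∷ xs) ≡ x + length xs
  perimeter-∷ x xs = cong (_∸ 1) (+-suc x (length xs))

  to : ∀ xs → xs ∈ ℋ (suc m) → xs ∈ map toList (partitions m)
  to xs xs∈ with Equivalence.to (∈-ℋ (suc m) xs) xs∈
  to []       _ | (() , _) , _
  to (x ∷ xs) _ | part , e =
    ∈-map⁺ toList (valid⇒∈-partitions m x xs (part , trans (sym (perimeter-∷ x xs)) e))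

  from : ∀ {xs} → xs ∈ map toList (partitions m) → xs ∈ ℋ (suc m)
  from xs∈ with (x , xs) , p∈ , refl ← ∈-map⁻ toList xs∈ with ∈-partitions⇒valid m p∈
  ... | part , e = Equivalence.from (∈-ℋ (suc m) (x ∷ xs)) (part , trans (perimeter-∷ x xs) e)

-- Sums over the partitions of a given perimeter

∑ : ℕ → (List⁺ → ℕ) → ℕ
∑ m f = sum (map f (partitions m))

∑ℋ≡∑ : ∀ m f → ∑ℋ (suc m) f ≡ ∑ m (f ∘ toList)
∑ℋ≡∑ m f = trans (sum-↭ (↭ₚ.map⁺ f (ℋ↭partitions m))) (cong sum (sym (map-∘ (partitions m))))

sum-map-mono : ∀ {A : Set} {f g : A → ℕ} → (∀ x → f x ≤ g x) → ∀ xs → sum (map f xs) ≤ sum (map g xs)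
sum-map-mono f≤g []       = z≤n
sum-map-mono f≤g (x ∷ xs) = +-mono-≤ (f≤g x) (sum-map-mono f≤g xs)

sum-map-+ : ∀ {A : Set} (f g : A → ℕ) xs → sum (map (λ x → f x + g x) xs) ≡ sum (map f xs) + sum (map g xs)
sum-map-+ f g []       = refl
sum-map-+ f g (x ∷ xs) =
  trans (cong (f x + g x +_) (sum-map-+ f g xs)) (interchange +-commutativeSemigroup (f x) (g x) (sum (map f xs)) (sum (map g xs)))

∑-mono : ∀ m {f g : List⁺ → ℕ} → (∀ p → f p ≤ g p) → ∑ m f ≤ ∑ m g
∑-mono m f≤g = sum-map-mono f≤g (partitions m)

∑-cong : ∀ m {f g : List⁺ → ℕ} → (∀ p → f p ≡ g p) → ∑ m f ≡ ∑ m g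
∑-cong m f≡g = ≤-antisym (∑-mono m (λ p → ≤-reflexive (f≡g p))) (∑-mono m (λ p → ≤-reflexive (sym (f≡g p))))

∑-+ : ∀ m f g → ∑ m (λ p → f p + g p) ≡ ∑ m f + ∑ m g
∑-+ m f g = sum-map-+ f g (partitions m)

-- The operator dual to the moves: it pulls a statistic back along the last move.
step : (List⁺ → ℕ) → List⁺ → ℕ
step f p = f (widen p) + f (repeat p)

∑-suc : ∀ m f → ∑ (suc m) f ≡ ∑ m (step f)
∑-suc m f = begin
  sum (map f (map widen P ++ map repeat P))              ≡⟨ cong sum (map-++ f (map widen P) (map repeat P)) ⟩
  sum (map f (map widen P) ++ map f (map repeat P))      ≡⟨ sum-++ (map f (map widen P)) _ ⟩
  sum (map f (map widen P)) + sum (map f (map repeat P)) ≡⟨ cong₂ _+_ (cong sum (map-∘ P)) (cong sum (map-∘ P)) ⟨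
  ∑ m (f ∘ widen) + ∑ m (f ∘ repeat)                     ≡⟨ ∑-+ m (f ∘ widen) (f ∘ repeat) ⟨
  ∑ m (step f)                                           ∎
  where
  open ≡-Reasoning
  P = partitions m

-- Reduces a comparison of counts over all parts or gaps to one of contributions at the head. The
-- contributions of the tails are handled by a mutual induction on the number of moves.
∑-heads : ∀ {f g : List ℕ → ℕ} {hf hg : List⁺ → ℕ} →
          (∀ p → f (toList p) ≡ hf p + f (proj₂ p)) →
          (∀ p → g (toList p) ≡ hg p + g (proj₂ p)) →
          f [] ≤ g [] → (∀ m → ∑ m hf ≤ ∑ m hg) →
          ∀ m → ∑ m (f ∘ toList) ≤ ∑ m (g ∘ toList)
∑-heads {f} {g} {hf} {hg} f-∷ g-∷ f[]≤g[] hf≤hg = full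
  where
  open ≤-Reasoning
  tails : ∀ m → ∑ m (f ∘ proj₂) ≤ ∑ m (g ∘ proj₂)
  full  : ∀ m → ∑ m (f ∘ toList) ≤ ∑ m (g ∘ toList)

  tails zero    = +-monoˡ-≤ 0 f[]≤g[]
  tails (suc m) = begin
    -- Widening keeps the tail, and repeating turns the whole former partition into the tail.
    ∑ (suc m) (f ∘ proj₂)                ≡⟨ ∑-suc m (f ∘ proj₂) ⟩
    ∑ m (step (f ∘ proj₂))               ≡⟨ ∑-+ m (f ∘ proj₂) (f ∘ toList) ⟩
    ∑ m (f ∘ proj₂) + ∑ m (f ∘ toList)   ≤⟨ +-mono-≤ (tails m) (full m) ⟩
    ∑ m (g ∘ proj₂) + ∑ m (g ∘ toList)   ≡⟨ ∑-+ m (g ∘ proj₂) (g ∘ toList) ⟨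
    ∑ m (step (g ∘ proj₂))               ≡⟨ ∑-suc m (g ∘ proj₂) ⟨
    ∑ (suc m) (g ∘ proj₂)                ∎

  full m = begin
    ∑ m (f ∘ toList)             ≡⟨ ∑-cong m f-∷ ⟩
    ∑ m (λ p → hf p + f (proj₂ p)) ≡⟨ ∑-+ m hf (f ∘ proj₂) ⟩
    ∑ m hf + ∑ m (f ∘ proj₂)     ≤⟨ +-mono-≤ (hf≤hg m) (tails m) ⟩
    ∑ m hg + ∑ m (g ∘ proj₂)     ≡⟨ ∑-+ m hg (g ∘ proj₂) ⟨
    ∑ m (λ p → hg p + g (proj₂ p)) ≡⟨ ∑-cong m g-∷ ⟨
    ∑ m (g ∘ toList)             ∎

-- Each complementary pair totals the number of partitions, so passing to complements reverses the
-- inequality.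
∑-complement : ∀ {f f′ g g′ : List⁺ → ℕ} →
               (∀ p → f p + f′ p ≡ 1) → (∀ p → g p + g′ p ≡ 1) →
               ∀ m → ∑ m g′ ≤ ∑ m f′ → ∑ m f ≤ ∑ m g
∑-complement {f} {f′} {g} {g′} ff′ gg′ m g′≤f′ = +-cancelʳ-≤ (∑ m f′) (∑ m f) (∑ m g) (begin
  ∑ m f + ∑ m f′           ≡⟨ ∑-+ m f f′ ⟨
  ∑ m (λ p → f p + f′ p)   ≡⟨ ∑-cong m (λ p → trans (ff′ p) (sym (gg′ p))) ⟩
  ∑ m (λ p → g p + g′ p)   ≡⟨ ∑-+ m g g′ ⟩
  ∑ m g + ∑ m g′           ≤⟨ +-monoʳ-≤ (∑ m g) g′≤f′ ⟩
  ∑ m g + ∑ m f′           ∎)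
  where open ≤-Reasoning

-- Indicators and the statistics of the first part and first gap

𝟙 : {P : Set} → Dec P → ℕ
𝟙 P? = if does P? then 1 else 0

𝟙-yes : {P : Set} (P? : Dec P) → P → 𝟙 P? ≡ 1
𝟙-yes (yes _) _ = refl
𝟙-yes (no ¬p) p = contradiction p ¬p

𝟙-mono : {P Q : Set} (P? : Dec P) (Q? : Dec Q) → (P → Q) → 𝟙 P? ≤ 𝟙 Q?
𝟙-mono (no _)  _  _   = z≤n
𝟙-mono (yes p) Q? P→Q = ≤-reflexive (sym (𝟙-yes Q? (P→Q p)))

𝟙≤1 : {P : Set} (P? : Dec P) → 𝟙 P? ≤ 1
𝟙≤1 (yes _) = ≤-refl
𝟙≤1 (no _)  = z≤n

𝟙-¬? : {P : Set} (P? : Dec P) → 𝟙 P? + 𝟙 (¬? P?) ≡ 1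
𝟙-¬? (yes _) = refl
𝟙-¬? (no _)  = refl

length-filter-∷ : {A : Set} {P : A → Set} (P? : ∀ x → Dec (P x)) → ∀ x xs →
                  length (filter P? (x ∷ xs)) ≡ 𝟙 (P? x) + length (filter P? xs)
length-filter-∷ P? x xs with does (P? x)
... | true  = refl
... | false = refl

firstGapBelow : ℕ → List⁺ → ℕ
firstGapBelow d (x , [])    = 0
firstGapBelow d (x , y ∷ _) = 𝟙 (x ∸ y <? d)

-- A single part has no first gap, so it gets the value 1 in order to complement `firstGapBelow`.
noFirstGapBelow : ℕ → List⁺ → ℕ
noFirstGapBelow d (x , [])    = 1
noFirstGapBelow d (x , y ∷ _) = 𝟙 (¬? (x ∸ y <? d))

first≡1 : ℕ → List⁺ → ℕ
first≡1 d (x , _) = 𝟙 (x % suc d ≟ 1 % suc d)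

first≢1 : ℕ → List⁺ → ℕ
first≢1 d (x , _) = 𝟙 (¬? (x % suc d ≟ 1 % suc d))

gapsBelow-∷ : ∀ d p → gapsBelow d (toList p) ≡ firstGapBelow d p + gapsBelow d (proj₂ p)
gapsBelow-∷ d (x , [])     = refl
gapsBelow-∷ d (x , y ∷ ys) = length-filter-∷ (λ (a , b) → a ∸ b <? d) (x , y) _

parts-∷ : ∀ d p → partsNot≡1Mod1+ d (toList p) ≡ first≢1 d p + partsNot≡1Mod1+ d (proj₂ p)
parts-∷ d (x , xs) = length-filter-∷ (λ x → ¬? (x % suc d ≟ 1 % suc d)) x xs

-- Partitions without a small first gap

noFirstGapBelow≤1 : ∀ d p → noFirstGapBelow d p ≤ 1
noFirstGapBelow≤1 d (x , [])    = ≤-refl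
noFirstGapBelow≤1 d (x , y ∷ _) = 𝟙≤1 (¬? (x ∸ y <? d))

-- Repeating creates a first gap 0, so only widening contributes.
step-noFirstGapBelow : ∀ j p → step (noFirstGapBelow (suc j)) p ≤ noFirstGapBelow j p
step-noFirstGapBelow j (x , xs) = begin
  noFirstGapBelow (suc j) (suc x , xs) + 𝟙 (¬? (x ∸ x <? suc j))  ≤⟨ +-mono-≤ (widened xs) repeated ⟩
  noFirstGapBelow j (x , xs) + 0                                  ≡⟨ +-identityʳ _ ⟩
  noFirstGapBelow j (x , xs)                                      ∎
  where
  open ≤-Reasoning
  repeated : 𝟙 (¬? (x ∸ x <? suc j)) ≤ 0
  repeated rewrite n∸n≡0 x = z≤n

  -- Strict for m < n, where truncation makes the left side 0.
  suc-∸-≤ : ∀ m n → suc m ∸ n ≤ suc (m ∸ n)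
  suc-∸-≤ m       zero    = ≤-refl
  suc-∸-≤ zero    (suc n) = ≤-trans (m∸n≤m 0 n) z≤n
  suc-∸-≤ (suc m) (suc n) = suc-∸-≤ m n

  widened : ∀ xs → noFirstGapBelow (suc j) (suc x , xs) ≤ noFirstGapBelow j (x , xs)
  widened []      = ≤-refl
  widened (y ∷ _) = 𝟙-mono (¬? (suc x ∸ y <? suc j)) (¬? (x ∸ y <? j))
    (λ ≮ lt → ≮ (≤-trans (s≤s (suc-∸-≤ x y)) (s≤s lt)))

-- Undoing the last j moves, all of them widenings for the partitions counted, lowers the threshold
-- by one each time.
∑-noFirstGapBelow : ∀ j k e → ∑ (j + k) (noFirstGapBelow (j + e)) ≤ ∑ k (noFirstGapBelow e)
∑-noFirstGapBelow zero    k e = ≤-refl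
∑-noFirstGapBelow (suc j) k e = begin
  ∑ (suc (j + k)) (noFirstGapBelow (suc (j + e)))  ≡⟨ ∑-suc (j + k) _ ⟩
  ∑ (j + k) (step (noFirstGapBelow (suc (j + e)))) ≤⟨ ∑-mono (j + k) (step-noFirstGapBelow (j + e)) ⟩
  ∑ (j + k) (noFirstGapBelow (j + e))              ≤⟨ ∑-noFirstGapBelow j k e ⟩
  ∑ k (noFirstGapBelow e)                          ∎
  where open ≤-Reasoning

-- Iterated moves and the residue of the first part

steps : ℕ → (List⁺ → ℕ) → List⁺ → ℕ
steps zero    f = f
steps (suc j) f = step (steps j f)

-- `steps j f p` totals `f` over the 2^j outcomes of j moves from p, so the sum is grouped by the
-- stage after k moves.
∑-steps : ∀ j k f → ∑ (j + k) f ≡ ∑ k (steps j f)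
∑-steps zero    k f = refl
∑-steps (suc j) k f = begin
  ∑ (suc j + k) f         ≡⟨ cong (λ n → ∑ n f) (+-suc j k) ⟨
  ∑ (j + suc k) f         ≡⟨ ∑-steps j (suc k) f ⟩
  ∑ (suc k) (steps j f)   ≡⟨ ∑-suc k (steps j f) ⟩
  ∑ k (step (steps j f))  ∎
  where open ≡-Reasoning

-- Widen t times, then repeat j - t times.
1≤steps-first≡1 : ∀ d j {t x} → t ≤ j → (x + t) % suc d ≡ 1 % suc d → ∀ xs → 1 ≤ steps j (first≡1 d) (x , xs)
1≤steps-first≡1 d zero    {x = x} z≤n e xs rewrite +-identityʳ x = ≤-reflexive (sym (𝟙-yes (x % suc d ≟ 1 % suc d) e))
1≤steps-first≡1 d (suc j) z≤n e xs = ≤-trans (1≤steps-first≡1 d j z≤n e _) (m≤n+m _ _)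
1≤steps-first≡1 d (suc j) {suc t} {x} (s≤s t≤j) e xs =
  ≤-trans (1≤steps-first≡1 d j t≤j (trans (cong (_% suc d) (sym (+-suc x t))) e) xs) (m≤m+n _ _)

-- As -x ≡ d x (mod d + 1), the number of increases is the residue of 1 + d x.
reach-1 : ∀ d x → (x + (1 + d * x) % suc d) % suc d ≡ 1 % suc d
reach-1 d x = begin
  (x + r) % n          ≡⟨ %-distribˡ-+ x r n ⟩
  (x % n + r % n) % n  ≡⟨ cong (λ z → (x % n + z) % n) (m%n%n≡m%n (1 + d * x) n) ⟩
  (x % n + r) % n      ≡⟨ %-distribˡ-+ x (1 + d * x) n ⟨
  (x + (1 + d * x)) % n ≡⟨ cong (_% n) (+-suc x (d * x)) ⟩
  (1 + n * x) % n      ≡⟨ cong (λ z → (1 + z) % n) (*-comm n x) ⟩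
  (1 + x * n) % n      ≡⟨ [m+kn]%n≡m%n 1 x n ⟩
  1 % n                ∎
  where
  open ≡-Reasoning
  n = suc d
  r = (1 + d * x) % n

1≤∑-first≡1 : ∀ d m → 1 ≤ ∑ m (first≡1 d)
1≤∑-first≡1 d m = begin
  -- Starting from the single part 1, no widening and m repetitions give the column of ones.
  1                                       ≤⟨ 1≤steps-first≡1 d m {0} {1} z≤n refl [] ⟩
  steps m (first≡1 d) (1 , [])            ≡⟨ +-identityʳ _ ⟨
  ∑ 0 (steps m (first≡1 d))               ≡⟨ ∑-steps m 0 (first≡1 d) ⟨
  ∑ (m + 0) (first≡1 d)                   ≡⟨ cong (λ n → ∑ n (first≡1 d)) (+-identityʳ m) ⟩
  ∑ m (first≡1 d)                         ∎
  where open ≤-Reasoning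

-- Comparison of the head statistics and conclusion

∑-noFirstGapBelow≤∑-first≡1 : ∀ d m → ∑ m (noFirstGapBelow d) ≤ ∑ m (first≡1 d)
∑-noFirstGapBelow≤∑-first≡1 d m with ≤-total m d
... | inj₁ m≤d = begin
  ∑ m (noFirstGapBelow d)                   ≡⟨ cong₂ (λ a b → ∑ a (noFirstGapBelow b)) (+-identityʳ m) (m+[n∸m]≡n m≤d) ⟨
  -- Undoing all m moves leaves only the partition (1), which contributes 1.
  ∑ (m + 0) (noFirstGapBelow (m + (d ∸ m))) ≤⟨ ∑-noFirstGapBelow m 0 (d ∸ m) ⟩
  1                                         ≤⟨ 1≤∑-first≡1 d m ⟩
  ∑ m (first≡1 d)                           ∎
  where open ≤-Reasoning
... | inj₂ d≤m = begin
  ∑ m (noFirstGapBelow d)             ≡⟨ cong₂ (λ a b → ∑ a (noFirstGapBelow b)) (m+[n∸m]≡n d≤m) (+-identityʳ d) ⟨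
  ∑ (d + k) (noFirstGapBelow (d + 0)) ≤⟨ ∑-noFirstGapBelow d k 0 ⟩
  -- Each stage after k moves counts at most once on the left, and has a continuation by d moves
  -- that counts on the right.
  ∑ k (noFirstGapBelow 0)             ≤⟨ ∑-mono k pointwise ⟩
  ∑ k (steps d (first≡1 d))           ≡⟨ ∑-steps d k (first≡1 d) ⟨
  ∑ (d + k) (first≡1 d)               ≡⟨ cong (λ a → ∑ a (first≡1 d)) (m+[n∸m]≡n d≤m) ⟩
  ∑ m (first≡1 d)                     ∎
  where
  open ≤-Reasoning
  k = m ∸ d
  pointwise : ∀ p → noFirstGapBelow 0 p ≤ steps d (first≡1 d) p
  pointwise p@(x , xs) = ≤-trans (noFirstGapBelow≤1 0 p)
    -- The number of widenings is a residue modulo d + 1, hence at most d, so d moves suffice.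
    (1≤steps-first≡1 d d (≤-pred (m%n<n (1 + d * x) (suc d))) (reach-1 d x) xs)

∑-first≢1≤∑-firstGapBelow : ∀ d m → ∑ m (first≢1 d) ≤ ∑ m (firstGapBelow d)
∑-first≢1≤∑-firstGapBelow d m = ∑-complement
  (λ (x , _) → trans (+-comm (𝟙 (¬? (x % suc d ≟ 1 % suc d))) _) (𝟙-¬? (x % suc d ≟ 1 % suc d)))
  (λ { (x , []) → refl ; (x , y ∷ _) → 𝟙-¬? (x ∸ y <? d) })
  m (∑-noFirstGapBelow≤∑-first≡1 d m)

theorem1p4 : (d n : ℕ) → 1 ≤ d → 1 ≤ n → ∑ℋ n (gapsBelow d) ≥ ∑ℋ n (partsNot≡1Mod1+ d)
theorem1p4 d (suc m) _ _ = begin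
  ∑ℋ (suc m) (partsNot≡1Mod1+ d)  ≡⟨ ∑ℋ≡∑ m (partsNot≡1Mod1+ d) ⟩
  -- The argument `z≤n` compares the counts on the empty tail, where both are 0.
  ∑ m (partsNot≡1Mod1+ d ∘ toList) ≤⟨ ∑-heads (parts-∷ d) (gapsBelow-∷ d) z≤n (∑-first≢1≤∑-firstGapBelow d) m ⟩
  ∑ m (gapsBelow d ∘ toList)       ≡⟨ ∑ℋ≡∑ m (gapsBelow d) ⟨
  ∑ℋ (suc m) (gapsBelow d)         ∎
  where open ≤-Reasoning
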